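{- Every $d$-dimensional perfect lattice $\Lambda$ has a $\mathbb Z$-basis $f_1,\dots,f_d$ such that every minimal vector $v=\sum_{i=1}^d\beta_if_i$ of $\Lambda$ (with $\beta_i\in\mathbb Z$) satisfies $|\beta_i|\le2^{i-1}I_d$ for $i=1,\dots,d$.
   Context: Minimal vectors are the nonzero vectors of minimal length. A $d$-dimensional lattice is perfect if $\{v\otimes v\}$, $v$ ranging over its minimal vectors, spans the $\binom{d+1}{2}$-dimensional space of symmetric tensors in $(\Lambda\otimes\mathbb R)^{\otimes2}$. A lattice is well-rounded if its minimal vectors span $\Lambda\otimes\mathbb R$. $I_d$ is the smallest integer such that whenever $\Lambda$ is a $d$-dimensional lattice and $\Lambda'\subseteq\Lambda$ is a $d$-dimensional well-rounded sublattice whose minimal vectors are all minimal vectors of $\Lambda$, the index $[\Lambda:\Lambda']$ is at most $I_d$. -}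

module Defs where

open import Level using (0ℓ) renaming (suc to lsuc)
open import Algebra.Bundles using (CommutativeRing)
open import Data.Fin.Base using (Fin)
open import Data.Integer.Base using (ℤ; +_; -[1+_]; 0ℤ)
open import Data.Nat.Base as ℕ using (ℕ; suc)
open import Data.Product.Base using (∃; ∃-syntax; Σ-syntax; _×_; _,_)
open import Data.Vec.Functional using (Vector)
open import Function.Base using (_∘_)
open import Function.Bundles using (_⇔_)
open import Relation.Binary.Core using (Rel)
open import Relation.Binary.PropositionalEquality.Core using (_≡_)
open import Relation.Binary.Structures using (IsTotalOrder)
open import Relation.Nullary.Negation.Core using (¬_)
open import Relation.Unary using (Pred; _∈_; _⊆_; _≐_)

-- Dedekind-complete ordered fields.  Classically there is exactly one up to
-- unique isomorphism, the field of real numbers, so quantifying over this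
-- record is how the development speaks about ℝ.
record CompleteOrderedField : Set (lsuc 0ℓ) where
  field
    commutativeRing : CommutativeRing 0ℓ 0ℓ
  open CommutativeRing commutativeRing public
  infix 4 _≤_
  field
    _≤_          : Rel Carrier 0ℓ
    isTotalOrder : IsTotalOrder _≈_ _≤_
    1≉0          : ¬ (1# ≈ 0#)
    inverse      : ∀ x → ¬ (x ≈ 0#) → ∃[ y ] x * y ≈ 1#
    +-monoʳ-≤    : ∀ x {y z} → y ≤ z → x + y ≤ x + z
    *-nonNeg     : ∀ {x y} → 0# ≤ x → 0# ≤ y → 0# ≤ x * y

  UpperBound : Pred Carrier 0ℓ → Pred Carrier 0ℓ
  UpperBound P u = ∀ {x} → x ∈ P → x ≤ u

  field
    complete : (P : Pred Carrier 0ℓ) → ∃ P → ∃ (UpperBound P) →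
               ∃[ s ] (s ∈ UpperBound P × (∀ {u} → u ∈ UpperBound P → s ≤ u))

module Lattices (ℝ-field : CompleteOrderedField) where

  open CompleteOrderedField ℝ-field
  open import Algebra.Properties.Semiring.Sum semiring using (sum-syntax)
  open import Algebra.Properties.Semiring.Mult semiring
    using () renaming (_×_ to _×ℕ_)

  ℝ : Set
  ℝ = Carrier

  fromℤ : ℤ → ℝ
  fromℤ (+ n)    = n ×ℕ 1#
  fromℤ -[1+ n ] = - (suc n ×ℕ 1#)

  -- For any index set A the functions A → ℝ form a real vector space;
  -- A = Fin d gives ℝᵈ and A = Fin d × Fin d gives ℝᵈ ⊗ ℝᵈ.

  infix 4 _≋_
  _≋_ : {A : Set} → Rel (A → ℝ) 0ℓ
  x ≋ y = ∀ a → x a ≈ y a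

  𝟎 : {A : Set} → A → ℝ
  𝟎 _ = 0#

  combination : {A : Set} {k : ℕ} → (Fin k → ℝ) → (Fin k → A → ℝ) → A → ℝ
  combination {k = k} c s a = ∑[ j < k ] (c j * s j a)

  ℤ-combination : {A : Set} {k : ℕ} → (Fin k → ℤ) → (Fin k → A → ℝ) → A → ℝ
  ℤ-combination β s = combination (fromℤ ∘ β) s

  Span : {A : Set} → Pred (A → ℝ) 0ℓ → Pred (A → ℝ) 0ℓ
  Span {A} S x = ∃[ k ] Σ[ c ∈ (Fin k → ℝ) ] Σ[ s ∈ (Fin k → A → ℝ) ]
    ((∀ j → s j ∈ S) × x ≋ combination c s)

  LinearlyIndependent : {A : Set} {k : ℕ} → (Fin k → A → ℝ) → Set
  LinearlyIndependent s = ∀ c → combination c s ≋ 𝟎 → ∀ i → c i ≈ 0#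

  module _ {d : ℕ} where

    _-ᵥ_ : Vector ℝ d → Vector ℝ d → Vector ℝ d
    (x -ᵥ y) i = x i - y i

    ‖_‖² : Vector ℝ d → ℝ
    ‖ x ‖² = ∑[ i < d ] (x i * x i)

    _⊗_ : Vector ℝ d → Vector ℝ d → (Fin d × Fin d → ℝ)
    (x ⊗ y) (i , j) = x i * y j

    SymmetricTensor : Pred (Fin d × Fin d → ℝ) 0ℓ
    SymmetricTensor T = ∀ i j → T (i , j) ≈ T (j , i)

    -- A d-dimensional lattice is realised in Euclidean ℝᵈ, as the ℤ-span of
    -- d linearly independent vectors; thus Λ ⊗ ℝ is all of ℝᵈ.
    IsLattice : Pred (Vector ℝ d) 0ℓ → Set
    IsLattice Λ = Σ[ b ∈ (Fin d → Vector ℝ d) ]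
      (LinearlyIndependent b × (∀ v → v ∈ Λ ⇔ (∃[ β ] v ≋ ℤ-combination β b)))

    record IsℤBasis (Λ : Pred (Vector ℝ d) 0ℓ) (f : Fin d → Vector ℝ d) : Set where
      field
        members     : ∀ i → f i ∈ Λ
        generates   : ∀ {v} → v ∈ Λ → ∃[ β ] v ≋ ℤ-combination β f
        independent : ∀ β → ℤ-combination β f ≋ 𝟎 → ∀ i → β i ≡ 0ℤ

    -- Lengths are compared through their squares.
    Minimal : Pred (Vector ℝ d) 0ℓ → Pred (Vector ℝ d) 0ℓ
    Minimal Λ v =
      v ∈ Λ × ¬ (v ≋ 𝟎) × (∀ {w} → w ∈ Λ → ¬ (w ≋ 𝟎) → ‖ v ‖² ≤ ‖ w ‖²)

    MinimalTensor : Pred (Vector ℝ d) 0ℓ → Pred (Fin d × Fin d → ℝ) 0ℓ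
    MinimalTensor Λ T = ∃[ v ] (v ∈ Minimal Λ × T ≋ (v ⊗ v))

    Perfect : Pred (Vector ℝ d) 0ℓ → Set
    Perfect Λ = Span (MinimalTensor Λ) ≐ SymmetricTensor

    WellRounded : Pred (Vector ℝ d) 0ℓ → Set
    WellRounded Λ = ∀ x → x ∈ Span (Minimal Λ)

    -- [Λ : Λ′] = n, witnessed by n representatives of the cosets of Λ′ in Λ.
    record HasIndex (Λ Λ′ : Pred (Vector ℝ d) 0ℓ) (n : ℕ) : Set where
      field
        rep      : Fin n → Vector ℝ d
        rep∈Λ    : ∀ i → rep i ∈ Λ
        covers   : ∀ {x} → x ∈ Λ → ∃[ i ] (x -ᵥ rep i) ∈ Λ′
        distinct : ∀ {i j} → (rep i -ᵥ rep j) ∈ Λ′ → i ≡ j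

  IndexBound : ℕ → ℕ → Set₁
  IndexBound d I = (Λ Λ′ : Pred (Vector ℝ d) 0ℓ) → IsLattice Λ → IsLattice Λ′ →
    Λ′ ⊆ Λ → WellRounded Λ′ → Minimal Λ′ ⊆ Minimal Λ →
    ∃[ n ] (HasIndex Λ Λ′ n × n ℕ.≤ I)

  -- "I is the number I_d".
  IsMaximalIndex : ℕ → ℕ → Set₁
  IsMaximalIndex d I = IndexBound d I × (∀ J → IndexBound d J → I ℕ.≤ J)

{-# OPTIONS --safe #-}

-- Since Λ is perfect, its minimal vectors span, so they contain a basis b of ℝᵈ.  The
-- sublattice spanned by b has finite index, so Λ lies in (1/N) ℤ-span b for some N, and
-- Λ has a basis f that is in row echelon form with respect to b and whose diagonal entries
-- dominate their columns.  If the i-th b-coordinate of a minimal vector v is nonzero, then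
-- exchanging bᵢ for v yields a well-rounded sublattice, whose index is at most I; as the
-- multiples 0, fᵢ, …, n fᵢ cannot be pairwise incongruent when n is the index, the i-th
-- b-coordinate of v is at most I times that of fᵢ.  Solving the triangular system
-- v = ∑ βᵢ fᵢ row by row at most doubles the bound with each row.

module Submission where

open import Defs
open import Level using (0ℓ)
open import Algebra.Bundles using (CommutativeRing)
open import Axiom.ExcludedMiddle using (ExcludedMiddle)
open import Data.Fin.Base using (Fin; zero; suc; toℕ; fromℕ<)
open import Data.Fin.Properties
  using (_≟_; punchInᵢ≢i; pigeonhole; toℕ<n; toℕ-fromℕ<; toℕ-injective)
open import Data.Integer.Base as ℤ using (ℤ; +_; -[1+_]; 0ℤ; 1ℤ; ∣_∣)
import Data.Integer.DivMod as ℤ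
import Data.Integer.Properties as ℤ
open import Data.Integer.Tactic.RingSolver using (solve-∀)
open import Data.Nat.Base as ℕ using (ℕ; zero; suc; _^_; _!)
open import Data.Nat.Divisibility using (divides; m≤n⇒m!∣n!; ∣-trans; m∣m*n)
open import Data.Nat.Induction using (<-rec)
import Data.Nat.Properties as ℕ
import Data.Nat.Tactic.RingSolver as ℕ
open import Data.Product.Base using (∃-syntax; Σ-syntax; _×_; _,_; proj₁; proj₂)
open import Data.Sum.Base using (inj₁; inj₂)
open import Data.Unit.Base using (⊤; tt)
open import Data.Vec.Functional using (Vector; updateAt; removeAt; _∷_; tail)
open import Data.Vec.Functional.Properties using (updateAt-updates; updateAt-minimal)
open import Function.Base using (_∘_; const; _∋_; id)
open import Function.Bundles using (mk⇔; Equivalence)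
open import Relation.Binary.PropositionalEquality as ≡ using (_≡_; _≢_; _≗_; subst)
open import Relation.Binary.Structures using (IsTotalOrder)
open import Relation.Nullary using (¬_; Dec; yes; no; contradiction)
open import Relation.Unary using (Pred; _∈_; _⊆_)

private variable
  A : Set
  k l d : ℕ

-- Finite linear combinations over a commutative ring.

module LinearCombinations (R : CommutativeRing 0ℓ 0ℓ) where

  open CommutativeRing R
  open import Algebra.Properties.Semiring.Sum semiring
  open import Relation.Binary.Reasoning.Setoid setoid

  lin : (Fin k → Carrier) → (Fin k → A → Carrier) → A → Carrier
  lin {k = k} c s a = ∑[ j < k ] (c j * s j a)

  lin-cong : ∀ {c c′ : Fin k → Carrier} {s s′ : Fin k → A → Carrier} {a} →
             (∀ j → c j ≈ c′ j) → (∀ j → s j a ≈ s′ j a) → lin c s a ≈ lin c′ s′ a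
  lin-cong {k = k} c≈c′ s≈s′ = sum-cong-≋ {k} λ j → *-cong (c≈c′ j) (s≈s′ j)

  lin-congˡ : ∀ {c c′ : Fin k → Carrier} {s : Fin k → A → Carrier} {a} →
              (∀ j → c j ≈ c′ j) → lin c s a ≈ lin c′ s a
  lin-congˡ {s = s} c≈c′ = lin-cong {s = s} {s′ = s} c≈c′ λ _ → refl

  sum-zero : (t : Fin k → Carrier) → (∀ j → t j ≈ 0#) → sum t ≈ 0#
  sum-zero {k} t t≈0 = trans (sum-cong-≋ t≈0) (sum-replicate-zero k)

  lin-zeroˡ : ∀ {c : Fin k → Carrier} {s : Fin k → A → Carrier} {a} →
              (∀ j → c j ≈ 0#) → lin c s a ≈ 0#
  lin-zeroˡ c≈0 = sum-zero _ λ j → trans (*-congʳ (c≈0 j)) (zeroˡ _)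

  lin-zeroʳ : ∀ {c : Fin k → Carrier} {s : Fin k → A → Carrier} {a} →
              (∀ j → s j a ≈ 0#) → lin c s a ≈ 0#
  lin-zeroʳ s≈0 = sum-zero _ λ j → trans (*-congˡ (s≈0 j)) (zeroʳ _)

  lin-+ : ∀ (c c′ : Fin k → Carrier) (s : Fin k → A → Carrier) a →
          lin (λ j → c j + c′ j) s a ≈ lin c s a + lin c′ s a
  lin-+ {k = k} c c′ s a =
    trans (sum-cong-≋ {k} λ j → distribʳ _ _ _) (∑-distrib-+ {k} _ _)

  lin-* : ∀ r (c : Fin k → Carrier) (s : Fin k → A → Carrier) a →
          lin (λ j → r * c j) s a ≈ r * lin c s a
  lin-* {k = k} r c s a = trans (sum-cong-≋ {k} λ j → *-assoc _ _ _)
                        (sym (*-distribˡ-sum r λ j → c j * s j a))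

  lin-scale : ∀ r (c : Fin k → Carrier) (s : Fin k → A → Carrier) a →
              lin c (λ j b → r * s j b) a ≈ r * lin c s a
  lin-scale {k = k} r c s a = trans
    (sum-cong-≋ {k} λ j → trans (sym (*-assoc _ _ _))
                     (trans (*-congʳ (*-comm _ _)) (*-assoc _ _ _)))
    (sym (*-distribˡ-sum r λ j → c j * s j a))

  -- Interchanging the two sums gives this associativity of the matrix product; it turns a
  -- combination of combinations into one of the innermost vectors.
  lin-lin : ∀ (c : Fin k → Carrier) (t : Fin k → Fin l → Carrier)
            (s : Fin l → A → Carrier) a →
            lin c (λ j → lin (t j) s) a ≈ lin (lin c t) s a
  lin-lin c t s a = begin
    ∑[ i < _ ] (c i * ∑[ j < _ ] (t i j * s j a))
      ≈⟨ sum-cong-≋ (λ i → *-distribˡ-sum (c i) λ j → t i j * s j a) ⟩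
    ∑[ i < _ ] ∑[ j < _ ] (c i * (t i j * s j a))
      ≈⟨ ∑-comm (λ i j → c i * (t i j * s j a)) ⟩
    ∑[ j < _ ] ∑[ i < _ ] (c i * (t i j * s j a))
      ≈⟨ sum-cong-≋ (λ j → trans
           (sum-cong-≋ λ i → sym (*-assoc (c i) (t i j) (s j a)))
           (sym (*-distribʳ-sum (s j a) λ i → c i * t i j))) ⟩
    ∑[ j < _ ] (∑[ i < _ ] (c i * t i j) * s j a) ∎

  -- Both sides are `t i + u i` plus the common sum over the indices other than `i`. Adding the
  -- opposite term on each side expresses the exchange without subtraction.
  sum-exchange : ∀ i (t u : Fin k → Carrier) → (∀ j → j ≢ i → t j ≈ u j) →
                 sum t + u i ≈ sum u + t i
  sum-exchange {suc k} i t u t≈u = begin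
    sum t + u i                        ≈⟨ +-congʳ (sum-remove t) ⟩
    (t i + sum (removeAt t i)) + u i   ≈⟨ +-assoc _ _ _ ⟩
    t i + (sum (removeAt t i) + u i)   ≈⟨ +-comm _ _ ⟩
    (sum (removeAt t i) + u i) + t i   ≈⟨ +-congʳ (+-comm _ _) ⟩
    (u i + sum (removeAt t i)) + t i
      ≈⟨ +-congʳ (+-congˡ (sum-cong-≋ λ j → t≈u _ (punchInᵢ≢i i j))) ⟩
    (u i + sum (removeAt u i)) + t i   ≈⟨ +-congʳ (sum-remove u) ⟨
    sum u + t i                        ∎

  sum-single : ∀ i (t : Fin k → Carrier) → (∀ j → j ≢ i → t j ≈ 0#) → sum t ≈ t i
  sum-single {k} i t t≈0 = begin
    sum t              ≈⟨ +-identityʳ _ ⟨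
    sum t + 0#         ≈⟨ sum-exchange i t (const 0#) t≈0 ⟩
    sum {k} (const 0#) + t i ≈⟨ +-congʳ (sum-replicate-zero k) ⟩
    0# + t i           ≈⟨ +-identityˡ _ ⟩
    t i                ∎

  unit : Fin k → Fin k → Carrier
  unit i j with i ≟ j
  ... | yes _ = 1#
  ... | no  _ = 0#

  unit-diag : ∀ (i : Fin k) → unit i i ≈ 1#
  unit-diag i with i ≟ i
  ... | yes _   = refl
  ... | no i≢i = contradiction ≡.refl i≢i

  unit-off : ∀ {i j : Fin k} → i ≢ j → unit i j ≈ 0#
  unit-off {i = i} {j} i≢j with i ≟ j
  ... | yes i≡j = contradiction i≡j i≢j
  ... | no _    = refl

  lin-unitˡ : ∀ i (s : Fin k → A → Carrier) a → lin (unit i) s a ≈ s i a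
  lin-unitˡ i s a = begin
    lin (unit i) s a   ≈⟨ sum-single i _ (λ j j≢i →
                            trans (*-congʳ (unit-off (j≢i ∘ ≡.sym))) (zeroˡ _)) ⟩
    unit i i * s i a   ≈⟨ *-congʳ (unit-diag i) ⟩
    1# * s i a         ≈⟨ *-identityˡ _ ⟩
    s i a              ∎

  lin-unitʳ : ∀ (c : Fin k → Carrier) i → lin c unit i ≈ c i
  lin-unitʳ c i = begin
    lin c unit i   ≈⟨ sum-single i _ (λ j j≢i → trans (*-congˡ (unit-off j≢i)) (zeroʳ _)) ⟩
    c i * unit i i ≈⟨ *-congˡ (unit-diag i) ⟩
    c i * 1#       ≈⟨ *-identityʳ _ ⟩
    c i            ∎

  -- The two families of summands differ only at `i`, so `sum-exchange` applies. Zeroing the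
  -- coefficient instead of dropping the index keeps the right side a combination of the original
  -- `s`.
  lin-replace : ∀ (c : Fin k → Carrier) (s : Fin k → A → Carrier) i w a →
    lin c (updateAt s i (const w)) a ≈ lin (updateAt c i (const 0#)) s a + c i * w a
  lin-replace c s i w a = begin
    sum t                ≈⟨ +-identityʳ _ ⟨
    sum t + 0#           ≈⟨ +-congˡ u-i ⟨
    sum t + u i          ≈⟨ sum-exchange i t u t≈u ⟩
    sum u + t i          ≈⟨ +-congˡ (reflexive (≡.cong (λ v → c i * v a) (updateAt-updates i s))) ⟩
    sum u + c i * w a    ∎
    where
    t u : Fin _ → Carrier
    t j = c j * updateAt s i (const w) j a
    u j = updateAt c i (const 0#) j * s j a
    u-i : u i ≈ 0#
    u-i = trans (*-congʳ (reflexive (updateAt-updates i c))) (zeroˡ _)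
    t≈u : ∀ j → j ≢ i → t j ≈ u j
    t≈u j j≢i = *-cong (reflexive (≡.sym (updateAt-minimal j i c j≢i)))
                       (reflexive (≡.cong (λ v → v a) (updateAt-minimal j i s j≢i)))

-- Integer matrices in row echelon form.

open LinearCombinations ℤ.+-*-commutativeRing using () renaming (lin to linℤ)
module Linℤ = LinearCombinations ℤ.+-*-commutativeRing

least : ExcludedMiddle 0ℓ → (P : Pred ℕ 0ℓ) → ∀ n → n ∈ P →
        ∃[ m ] (m ∈ P × (∀ {k} → k ℕ.< m → ¬ (k ∈ P)))
least em P = <-rec _ λ n rec n∈P → descend rec n∈P em
  where
  Least = ∃[ m ] (m ∈ P × (∀ {k} → k ℕ.< m → ¬ (k ∈ P)))
  descend : ∀ {n} → (∀ {m} → m ℕ.< n → m ∈ P → Least) → n ∈ P →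
            Dec (∃[ m ] (m ℕ.< n × m ∈ P)) → Least
  descend rec _   (yes (m , m<n , m∈P)) = rec m<n m∈P
  descend _   n∈P (no none)             = _ , n∈P , λ k<n k∈P → none (_ , k<n , k∈P)

minor : (Fin (suc d) → Fin (suc d) → ℤ) → Fin d → Fin d → ℤ
minor f i j = f (suc i) (suc j)

-- A Hermite normal form without sign conventions and with weak inequalities: the rows are the
-- vectors, the matrix is upper triangular, and each diagonal entry dominates the entries above it.
-- Peeling off the first row and column lets the arguments below go by induction on `d`.
IsReduced : ∀ d → (Fin d → Fin d → ℤ) → Set
IsReduced zero    f = ⊤
IsReduced (suc d) f =
  ℤ.NonZero (f zero zero) × (∀ i → f (suc i) zero ≡ 0ℤ) ×
  (∀ i → ∣ f zero (suc i) ∣ ℕ.≤ ∣ f (suc i) (suc i) ∣) × IsReduced d (minor f)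

lin-head : ∀ (f : Fin (suc d) → Fin (suc d) → ℤ) → (∀ i → f (suc i) zero ≡ 0ℤ) →
           ∀ β → linℤ β f zero ≡ β zero ℤ.* f zero zero
lin-head f f₀ β = ≡.trans
  (≡.cong (ℤ._+_ (β zero ℤ.* f zero zero)) (Linℤ.lin-zeroʳ {c = tail β} {s = f ∘ suc} f₀))
  (ℤ.+-identityʳ _)

-- Division with remainder by the pivots, from left to right. The first quotient depends on
-- coordinate zero alone, because the lower rows vanish there; its effect on the other coordinates
-- is subtracted before the recursive call.
reduce : ∀ d f → IsReduced d f → ∀ (z : Fin d → ℤ) →
         ∃[ β ] (∀ i → ∣ z i ℤ.- linℤ β f i ∣ ℕ.≤ ∣ f i i ∣)
reduce zero    f _ z = (λ ()) , λ ()
reduce (suc d) f (nz , f₀ , _ , rest) z = q ∷ β′ , bound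
  where
  instance _ = nz
  q = z zero ℤ./ f zero zero
  r = z zero ℤ.% f zero zero
  ih = reduce d (minor f) rest (λ j → z (suc j) ℤ.- q ℤ.* f zero (suc j))
  β′ = proj₁ ih
  remainder : z zero ℤ.- linℤ (q ∷ β′) f zero ≡ + r
  remainder = ≡.trans
    (≡.cong₂ ℤ._-_ (ℤ.a≡a%n+[a/n]*n (z zero) (f zero zero)) (lin-head f f₀ (q ∷ β′)))
    (((∀ a b → (a ℤ.+ b) ℤ.- b ≡ a) ∋ solve-∀) (+ r) (q ℤ.* f zero zero))
  bound : ∀ i → ∣ z i ℤ.- linℤ (q ∷ β′) f i ∣ ℕ.≤ ∣ f i i ∣
  bound zero    = subst (λ x → ∣ x ∣ ℕ.≤ _) (≡.sym remainder)
                        (ℕ.<⇒≤ (ℤ.n%d<d (z zero) (f zero zero)))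
  bound (suc j) = subst (λ x → ∣ x ∣ ℕ.≤ _)
    (((∀ a b c → (a ℤ.- b) ℤ.- c ≡ a ℤ.- (b ℤ.+ c)) ∋ solve-∀) (z (suc j)) _ _) (proj₂ ih j)

-- Forward substitution. Only the first row meets column zero, so the first coefficient is at most
-- `C`. By dominance, moving that row to the other side costs at most `C` times the diagonal entry
-- in every later column, so the minor satisfies the hypothesis with twice the constant.
coefficient-bound : ∀ d f → IsReduced d f → ∀ C β →
  (∀ i → ∣ linℤ β f i ∣ ℕ.≤ C ℕ.* ∣ f i i ∣) → ∀ i → ∣ β i ∣ ℕ.≤ 2 ^ toℕ i ℕ.* C
coefficient-bound (suc d) f (nz , f₀ , dom , rest) C β hyp = bound
  where
  instance _ = nz
  β₀≤C : ∣ β zero ∣ ℕ.≤ C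
  β₀≤C = ℕ.*-cancelʳ-≤ _ _ ∣ f zero zero ∣ (begin
    ∣ β zero ∣ ℕ.* ∣ f zero zero ∣ ≡⟨ ℤ.abs-* (β zero) _ ⟨
    ∣ β zero ℤ.* f zero zero ∣     ≡⟨ ≡.cong ∣_∣ (lin-head f f₀ β) ⟨
    ∣ linℤ β f zero ∣              ≤⟨ hyp zero ⟩
    C ℕ.* ∣ f zero zero ∣          ∎)
    where open ℕ.≤-Reasoning
  hyp′ : ∀ j → ∣ linℤ (tail β) (minor f) j ∣ ℕ.≤ (2 ℕ.* C) ℕ.* ∣ minor f j j ∣
  hyp′ j = begin
    ∣ y ∣
      ≡⟨ ≡.cong ∣_∣ (((∀ a b → b ≡ (a ℤ.+ b) ℤ.- a) ∋ solve-∀) x y) ⟩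
    ∣ (x ℤ.+ y) ℤ.- x ∣
      ≤⟨ ℤ.∣i-j∣≤∣i∣+∣j∣ (x ℤ.+ y) x ⟩
    ∣ linℤ β f (suc j) ∣ ℕ.+ ∣ x ∣
      ≤⟨ ℕ.+-mono-≤ (hyp (suc j)) (ℕ.≤-trans (ℕ.≤-reflexive (ℤ.abs-* (β zero) _))
                                             (ℕ.*-mono-≤ β₀≤C (dom j))) ⟩
    C ℕ.* D ℕ.+ C ℕ.* D
      ≡⟨ ((∀ c e → c ℕ.* e ℕ.+ c ℕ.* e ≡ (2 ℕ.* c) ℕ.* e) ∋ ℕ.solve-∀) C D ⟩
    (2 ℕ.* C) ℕ.* D ∎
    where
    open ℕ.≤-Reasoning
    x = β zero ℤ.* f zero (suc j)
    y = linℤ (tail β) (minor f) j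
    D = ∣ minor f j j ∣
  bound : ∀ i → ∣ β i ∣ ℕ.≤ 2 ^ toℕ i ℕ.* C
  bound zero    = ℕ.≤-trans β₀≤C (ℕ.≤-reflexive (≡.sym (ℕ.*-identityˡ C)))
  bound (suc i) = ℕ.≤-trans (coefficient-bound d (minor f) rest (2 ℕ.* C) (tail β) hyp′ i)
    (ℕ.≤-reflexive (((∀ a c → a ℕ.* (2 ℕ.* c) ≡ (2 ℕ.* a) ℕ.* c) ∋ ℕ.solve-∀) (2 ^ toℕ i) C))

-- Subgroups of ℤᵈ and their reduced bases.

record IsSubgroup {d} (H : Pred (Fin d → ℤ) 0ℓ) : Set where
  field
    resp   : ∀ {x y} → x ≗ y → x ∈ H → y ∈ H
    0∈ : const 0ℤ ∈ H
    -- This one law covers sums, differences and, with zero in place of `x`, integer multiples.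
    closed : ∀ p {x y} → x ∈ H → y ∈ H → (λ j → x j ℤ.+ p ℤ.* y j) ∈ H

  lin-closed : ∀ (f : Fin k → Fin d → ℤ) → (∀ j → f j ∈ H) → ∀ β → linℤ β f ∈ H
  lin-closed {zero}  f f∈ β = 0∈
  lin-closed {suc k} f f∈ β = resp (λ j → ℤ.+-comm (linℤ (tail β) (tail f) j) _)
    (closed (β zero) (lin-closed (tail f) (f∈ ∘ suc) (tail β)) (f∈ zero))

-- Induction on `d`. That `H` contains all multiples of `N` gives it full rank and is inherited by
-- `H′`, the elements with first coordinate zero. An element with least nonzero first coordinate, up
-- to sign, generates `H` together with `H′`; reducing it modulo the basis of `H′` makes the
-- diagonal dominant.
reduced-basis : ExcludedMiddle 0ℓ → ∀ d (H : Pred (Fin d → ℤ) 0ℓ) → IsSubgroup H →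
  ∀ N .{{_ : ℤ.NonZero N}} → (∀ (z : Fin d → ℤ) → (λ j → N ℤ.* z j) ∈ H) →
  ∃[ f ] (IsReduced d f × (∀ i → f i ∈ H) × (∀ {z} → z ∈ H → ∃[ β ] z ≗ linℤ β f))
reduced-basis em zero    H _   N N∈ = (λ ()) , tt , (λ ()) , λ _ → (λ ()) , λ ()
reduced-basis em (suc d) H sub N N∈ = f , reduced , f∈H , generates
  where
  open IsSubgroup sub

  H′ : Pred (Fin d → ℤ) 0ℓ
  H′ z = (0ℤ ∷ z) ∈ H

  sub′ : IsSubgroup H′
  sub′ = record
    { resp   = λ x≗y → resp λ { zero → ≡.refl ; (suc j) → x≗y j }
    ; 0∈ = resp (λ { zero → ≡.refl ; (suc j) → ≡.refl }) 0∈
    ; closed = λ p x∈ y∈ → resp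
        (λ { zero → ≡.trans (ℤ.+-identityˡ _) (ℤ.*-zeroʳ p) ; (suc j) → ≡.refl })
        (closed p x∈ y∈)
    }

  ih = reduced-basis em d H′ sub′ N
    (λ z → resp (λ { zero → ℤ.*-zeroʳ N ; (suc j) → ≡.refl }) (N∈ (0ℤ ∷ z)))
  f′ = proj₁ ih
  reduced′ = proj₁ (proj₂ ih)
  f′∈H′ = proj₁ (proj₂ (proj₂ ih))
  generates′ = proj₂ (proj₂ (proj₂ ih))

  lower : Fin d → Fin (suc d) → ℤ
  lower i = 0ℤ ∷ f′ i

  lower-zero : ∀ β → linℤ β lower zero ≡ 0ℤ
  lower-zero β = Linℤ.lin-zeroʳ {c = β} {s = lower} {a = zero} λ _ → ≡.refl

  -- Indexing by the predecessor of the absolute value excludes a zero first coordinate from the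
  -- minimisation.
  P : Pred ℕ 0ℓ
  P n = ∃[ z ] (z ∈ H × ∣ z zero ∣ ≡ suc n)

  suc-pred : ∀ x .{{_ : ℤ.NonZero x}} → ∣ x ∣ ≡ suc (ℕ.pred ∣ x ∣)
  suc-pred x = ≡.sym (ℕ.suc-pred ∣ x ∣)

  -- The search starts from the vector all of whose entries are `N`.
  minimum = least em P (ℕ.pred ∣ N ∣)
    ((λ j → N ℤ.* 1ℤ) , N∈ (const 1ℤ) , ≡.trans (≡.cong ∣_∣ (ℤ.*-identityʳ N)) (suc-pred N))
  p = proj₁ minimum
  z₀ = proj₁ (proj₁ (proj₂ minimum))
  z₀∈H = proj₁ (proj₂ (proj₁ (proj₂ minimum)))
  ∣z₀∣ = proj₂ (proj₂ (proj₁ (proj₂ minimum)))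
  p-least = proj₂ (proj₂ minimum)

  -- Subtracting this combination of lower rows makes the later entries of the top row small and
  -- leaves its first entry alone.
  γ = proj₁ (reduce d f′ reduced′ (z₀ ∘ suc))

  top : Fin (suc d) → ℤ
  top j = z₀ j ℤ.+ ℤ.- 1ℤ ℤ.* linℤ γ lower j

  minus : ∀ a b → a ℤ.+ ℤ.- 1ℤ ℤ.* b ≡ a ℤ.- b
  minus = solve-∀

  top-zero : top zero ≡ z₀ zero
  top-zero = ≡.trans
    (≡.cong (λ x → z₀ zero ℤ.+ ℤ.- 1ℤ ℤ.* x) (lower-zero γ))
    (((∀ a → a ℤ.+ ℤ.- 1ℤ ℤ.* 0ℤ ≡ a) ∋ solve-∀) (z₀ zero))

  ∣top∣ : ∣ top zero ∣ ≡ suc p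
  ∣top∣ = ≡.trans (≡.cong ∣_∣ top-zero) ∣z₀∣

  instance
    top≢0 : ℤ.NonZero (top zero)
    top≢0 = ≡.subst ℕ.NonZero (≡.sym ∣top∣) _

  f : Fin (suc d) → Fin (suc d) → ℤ
  f = top ∷ lower

  f∈H : ∀ i → f i ∈ H
  f∈H zero    = closed (ℤ.- 1ℤ) z₀∈H (lin-closed lower f′∈H′ γ)
  f∈H (suc i) = f′∈H′ i

  reduced : IsReduced (suc d) f
  reduced = top≢0 , (λ _ → ≡.refl) ,
    (λ i → subst (λ x → ∣ x ∣ ℕ.≤ ∣ f′ i i ∣) (≡.sym (minus (z₀ (suc i)) _))
                 (proj₂ (reduce d f′ reduced′ (z₀ ∘ suc)) i)) ,
    reduced′

  generates : ∀ {z} → z ∈ H → ∃[ β ] z ≗ linℤ β f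
  generates {z} z∈H = q ∷ proj₁ tail-combination , eq
    where
    q = z zero ℤ./ top zero
    r = z zero ℤ.% top zero
    y : Fin (suc d) → ℤ
    y j = z j ℤ.+ ℤ.- q ℤ.* top j
    y∈H : y ∈ H
    y∈H = closed (ℤ.- q) z∈H (f∈H zero)
    y₀≡r : y zero ≡ + r
    y₀≡r = ≡.trans
      (≡.cong (λ x → x ℤ.+ ℤ.- q ℤ.* top zero) (ℤ.a≡a%n+[a/n]*n (z zero) (top zero)))
      (((∀ a b c → (a ℤ.+ b ℤ.* c) ℤ.+ ℤ.- b ℤ.* c ≡ a) ∋ solve-∀) (+ r) q (top zero))
    -- A positive remainder would be the first coordinate of `y`, an element of `H`, and would
    -- undercut the minimum. The copy `s` of `r` is there to be matched on.
    r≡0 : ∀ s → s ≡ r → s ≡ 0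
    r≡0 zero    _   = ≡.refl
    r≡0 (suc s) s≡r = contradiction (y , y∈H , ≡.trans (≡.cong ∣_∣ y₀≡r) (≡.sym s≡r))
      (p-least (ℕ.s<s⁻¹ (≡.subst₂ ℕ._<_ (≡.sym s≡r) ∣top∣ (ℤ.n%d<d (z zero) (top zero)))))
    y₀≡0 : y zero ≡ 0ℤ
    y₀≡0 = ≡.trans y₀≡r (≡.cong +_ (r≡0 r ≡.refl))
    tail-combination = generates′ (resp (λ { zero → y₀≡0 ; (suc j) → ≡.refl }) y∈H)
    split : ∀ a b c → a ≡ b ℤ.* c ℤ.+ (a ℤ.+ ℤ.- b ℤ.* c)
    split = solve-∀
    eq : z ≗ linℤ (q ∷ proj₁ tail-combination) f
    eq zero    = ≡.trans (split (z zero) q (top zero)) (≡.cong (ℤ._+_ (q ℤ.* top zero))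
      (≡.trans y₀≡0 (≡.sym (lower-zero (proj₁ tail-combination)))))
    eq (suc j) = ≡.trans (split (z (suc j)) q (top (suc j)))
      (≡.cong (ℤ._+_ (q ℤ.* top (suc j))) (proj₂ tail-combination j))

diagonal-nonZero : ∀ d f → IsReduced d f → ∀ i → f i i ≢ 0ℤ
diagonal-nonZero (suc d) f (nz , _) zero f₀₀≡0 =
  ℕ.≢-nonZero⁻¹ ∣ f zero zero ∣ {{nz}} (≡.cong ∣_∣ f₀₀≡0)
diagonal-nonZero (suc d) f (_ , _ , _ , rest) (suc i) = diagonal-nonZero d (minor f) rest i

updateAt-∈ : ∀ (P : Pred A 0ℓ) (s : Fin k → A) i {w} → (∀ j → s j ∈ P) → w ∈ P →
             ∀ j → updateAt s i (const w) j ∈ P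
updateAt-∈ P s i {w} s∈ w∈ j with j ≟ i
... | yes ≡.refl = subst P (≡.sym (updateAt-updates i s)) w∈
... | no j≢i     = subst P (≡.sym (updateAt-minimal j i s j≢i)) (s∈ j)

-- Ordered-field arithmetic and the embedding of ℤ.

module Field (ℝ-field : CompleteOrderedField) where
  open CompleteOrderedField ℝ-field hiding (zero)
  open Lattices ℝ-field
  open LinearCombinations commutativeRing
  open import Algebra.Properties.Ring ring
  open import Algebra.Properties.CommutativeSemigroup *-commutativeSemigroup using (x∙yz≈y∙xz)
  open import Algebra.Properties.Semiring.Sum semiring using (sum-cong-≋; *-distribˡ-sum)
  open import Algebra.Properties.Semiring.Mult semiring
    using (×-homo-+; ×1-homo-*) renaming (_×_ to _×ℕ_)
  open import Relation.Binary.Reasoning.Setoid setoid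
  open IsTotalOrder isTotalOrder using (antisym; total)
    renaming (trans to ≤-trans; ≤-respʳ-≈ to ≤-respʳ; ≤-respˡ-≈ to ≤-respˡ;
              reflexive to ≤-reflexive)

  cancel-right : ∀ x y → (x + y) - y ≈ x
  cancel-right x y = trans (+-assoc _ _ _) (trans (+-congˡ (-‿inverseʳ y)) (+-identityʳ x))

  restore-right : ∀ x y → (x - y) + y ≈ x
  restore-right x y = trans (+-assoc _ _ _) (trans (+-congˡ (-‿inverseˡ y)) (+-identityʳ x))

  *-cancelˡ-nonzero : ∀ a {x y} → ¬ (a ≈ 0#) → a * x ≈ a * y → x ≈ y
  *-cancelˡ-nonzero a {x} {y} a≉0 ax≈ay = begin
    x             ≈⟨ undo x ⟨
    a⁻¹ * (a * x) ≈⟨ *-congˡ ax≈ay ⟩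
    a⁻¹ * (a * y) ≈⟨ undo y ⟩
    y             ∎
    where
    a⁻¹ = proj₁ (inverse a a≉0)
    undo : ∀ z → a⁻¹ * (a * z) ≈ z
    undo z = trans (sym (*-assoc _ _ _)) (trans
      (*-congʳ (trans (*-comm _ _) (proj₂ (inverse a a≉0)))) (*-identityˡ z))

  ≉0-product : ∀ {x y} → ¬ (x ≈ 0#) → x * y ≈ 0# → y ≈ 0#
  ≉0-product {x} x≉0 xy≈0 = *-cancelˡ-nonzero x x≉0 (trans xy≈0 (sym (zeroʳ x)))

  0≤1 : 0# ≤ 1#
  0≤1 with total 0# 1#
  ... | inj₁ 0≤1 = 0≤1
  -- In this case `- 1#` is nonnegative, hence so is its square, which is `1#`.
  ... | inj₂ 1≤0 = ≤-respʳ (trans (sym (-‿distribˡ-* 1# (- 1#)))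
      (trans (-‿cong (*-identityˡ _)) (-‿involutive 1#))) (*-nonNeg 0≤-1 0≤-1)
    where
    0≤-1 : 0# ≤ - 1#
    0≤-1 = ≤-respˡ (-‿inverseˡ 1#) (≤-respʳ (+-identityʳ _) (+-monoʳ-≤ (- 1#) 1≤0))

  0≤n : ∀ n → 0# ≤ n ×ℕ 1#
  0≤n zero    = ≤-reflexive refl
  0≤n (suc n) = ≤-trans 0≤1 (≤-respˡ (+-identityʳ _) (+-monoʳ-≤ 1# (0≤n n)))

  -- Characteristic zero comes from the order: `1#` is at most `suc n ×ℕ 1#`, so if the latter
  -- vanished, antisymmetry would give `1# ≈ 0#`.
  suc≉0 : ∀ n → ¬ (suc n ×ℕ 1# ≈ 0#)
  suc≉0 n n≈0 = 1≉0 (antisym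
    (≤-respʳ n≈0 (≤-respˡ (+-identityʳ _) (+-monoʳ-≤ 1# (0≤n n)))) 0≤1)

  fromℤ-≡0 : ∀ z → fromℤ z ≈ 0# → z ≡ 0ℤ
  fromℤ-≡0 (+ zero)  _   = ≡.refl
  fromℤ-≡0 (+ suc n) z≈0 = contradiction z≈0 (suc≉0 n)
  fromℤ-≡0 -[1+ n ]  z≈0 = contradiction
    (trans (sym (-‿involutive _)) (trans (-‿cong z≈0) -0#≈0#)) (suc≉0 n)

  fromℤ-⊖ : ∀ m n → fromℤ (m ℤ.⊖ n) ≈ m ×ℕ 1# - n ×ℕ 1#
  fromℤ-⊖ zero    zero    = sym (-‿inverseʳ 0#)
  fromℤ-⊖ zero    (suc n) = sym (+-identityˡ _)
  fromℤ-⊖ (suc m) zero    = sym (trans (+-congˡ -0#≈0#) (+-identityʳ _))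
  fromℤ-⊖ (suc m) (suc n) = begin
    fromℤ (suc m ℤ.⊖ suc n)  ≈⟨ reflexive (≡.cong fromℤ (ℤ.[1+m]⊖[1+n]≡m⊖n m n)) ⟩
    fromℤ (m ℤ.⊖ n)          ≈⟨ fromℤ-⊖ m n ⟩
    x - y                    ≈⟨ +-congʳ (cancel-right x 1#) ⟨
    ((x + 1#) - 1#) - y      ≈⟨ +-assoc _ _ _ ⟩
    (x + 1#) + (- 1# - y)    ≈⟨ +-cong (+-comm x 1#) (-‿+-comm 1# y) ⟩
    (1# + x) - (1# + y)      ∎
    where
    x = m ×ℕ 1#
    y = n ×ℕ 1#

  fromℤ-+ : ∀ a b → fromℤ (a ℤ.+ b) ≈ fromℤ a + fromℤ b
  fromℤ-+ (+ m)    (+ n)    = ×-homo-+ 1# m n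
  fromℤ-+ (+ m)    -[1+ n ] = fromℤ-⊖ m (suc n)
  fromℤ-+ -[1+ m ] (+ n)    = trans (fromℤ-⊖ n (suc m)) (+-comm _ _)
  fromℤ-+ -[1+ m ] -[1+ n ] = begin
    - (suc (suc (m ℕ.+ n)) ×ℕ 1#)
      ≈⟨ -‿cong (reflexive (≡.cong (λ e → suc e ×ℕ 1#) (ℕ.+-suc m n))) ⟨
    - ((suc m ℕ.+ suc n) ×ℕ 1#)         ≈⟨ -‿cong (×-homo-+ 1# (suc m) (suc n)) ⟩
    - (suc m ×ℕ 1# + suc n ×ℕ 1#)      ≈⟨ -‿+-comm _ _ ⟨
    - (suc m ×ℕ 1#) - suc n ×ℕ 1#      ∎

  fromℤ-neg : ∀ a → fromℤ (ℤ.- a) ≈ - fromℤ a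
  fromℤ-neg (+ zero)  = sym -0#≈0#
  fromℤ-neg (+ suc n) = refl
  fromℤ-neg -[1+ n ]  = sym (-‿involutive _)

  fromℤ-pos* : ∀ m b → fromℤ (+ m ℤ.* b) ≈ fromℤ (+ m) * fromℤ b
  fromℤ-pos* m (+ n)    = trans (reflexive (≡.cong fromℤ (≡.sym (ℤ.pos-* m n)))) (×1-homo-* m n)
  fromℤ-pos* m -[1+ n ] = begin
    fromℤ (+ m ℤ.* -[1+ n ])
      ≈⟨ reflexive (≡.cong fromℤ (ℤ.neg-distribʳ-* (+ m) (+ suc n))) ⟨
    fromℤ (ℤ.- (+ m ℤ.* + suc n))    ≈⟨ fromℤ-neg (+ m ℤ.* + suc n) ⟩
    - fromℤ (+ m ℤ.* + suc n)        ≈⟨ -‿cong (fromℤ-pos* m (+ suc n)) ⟩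
    - (fromℤ (+ m) * fromℤ (+ suc n)) ≈⟨ -‿distribʳ-* _ _ ⟩
    fromℤ (+ m) * fromℤ -[1+ n ]      ∎

  fromℤ-* : ∀ a b → fromℤ (a ℤ.* b) ≈ fromℤ a * fromℤ b
  fromℤ-* (+ m)    b = fromℤ-pos* m b
  fromℤ-* -[1+ m ] b = begin
    fromℤ (-[1+ m ] ℤ.* b)        ≈⟨ reflexive (≡.cong fromℤ (ℤ.neg-distribˡ-* (+ suc m) b)) ⟨
    fromℤ (ℤ.- (+ suc m ℤ.* b))   ≈⟨ fromℤ-neg (+ suc m ℤ.* b) ⟩
    - fromℤ (+ suc m ℤ.* b)       ≈⟨ -‿cong (fromℤ-pos* (suc m) b) ⟩
    - (fromℤ (+ suc m) * fromℤ b) ≈⟨ -‿distribˡ-* _ _ ⟩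
    fromℤ -[1+ m ] * fromℤ b      ∎

  fromℤ-injective : ∀ a b → fromℤ a ≈ fromℤ b → a ≡ b
  fromℤ-injective a b a≈b = ℤ.i-j≡0⇒i≡j a b (fromℤ-≡0 (a ℤ.- b) (begin
    fromℤ (a ℤ.- b)           ≈⟨ fromℤ-+ a (ℤ.- b) ⟩
    fromℤ a + fromℤ (ℤ.- b)   ≈⟨ +-cong a≈b (fromℤ-neg b) ⟩
    fromℤ b - fromℤ b         ≈⟨ -‿inverseʳ _ ⟩
    0#                        ∎))

  fromℤ-lin : ∀ (c : Fin k → ℤ) (t : Fin k → Fin l → ℤ) j →
              fromℤ (linℤ c t j) ≈ lin (fromℤ ∘ c) (λ i → fromℤ ∘ t i) j
  fromℤ-lin {zero}  c t j = refl
  fromℤ-lin {suc k} c t j = trans (fromℤ-+ (c zero ℤ.* t zero j) _)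
    (+-cong (fromℤ-* (c zero) (t zero j)) (fromℤ-lin (c ∘ suc) (t ∘ suc) j))

  -- Bases of ℝᵈ and the exchange of one vector.

  record IsBasis {d} (b : Fin d → Vector ℝ d) : Set where
    field
      independent : LinearlyIndependent b
      spanning    : ∀ x → ∃[ c ] x ≋ combination c b

    unique : ∀ c c′ → combination c b ≋ combination c′ b → ∀ i → c i ≈ c′ i
    unique c c′ eq i = begin
      c i                     ≈⟨ restore-right (c i) (c′ i) ⟨
      (c i - c′ i) + c′ i     ≈⟨ +-congʳ (+-congˡ (-1*x≈-x (c′ i))) ⟨
      (c i + - 1# * c′ i) + c′ i ≈⟨ +-congʳ (independent (λ j → c j + - 1# * c′ j) zero-comb i) ⟩
      0# + c′ i               ≈⟨ +-identityˡ _ ⟩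
      c′ i                    ∎
      where
      zero-comb : combination (λ j → c j + - 1# * c′ j) b ≋ 𝟎
      zero-comb a = begin
        combination (λ j → c j + - 1# * c′ j) b a
          ≈⟨ lin-+ c (λ j → - 1# * c′ j) b a ⟩
        combination c b a + combination (λ j → - 1# * c′ j) b a
          ≈⟨ +-cong (eq a) (trans (lin-* (- 1#) c′ b a) (-1*x≈-x _)) ⟩
        combination c′ b a - combination c′ b a
          ≈⟨ -‿inverseʳ _ ⟩
        0# ∎

  unit-isBasis : IsBasis {d} unit
  unit-isBasis = record
    { independent = λ c eq i → trans (sym (lin-unitʳ c i)) (eq i)
    ; spanning    = λ x → x , λ i → sym (lin-unitʳ x i)
    }

  module Exchange {b : Fin d → Vector ℝ d} (basis : IsBasis b) (i : Fin d)
                  {w : Vector ℝ d} {α : Fin d → ℝ} (w≋ : w ≋ combination α b)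
                  (αᵢ≉0 : ¬ (α i ≈ 0#)) where
    open IsBasis basis

    b′ : Fin d → Vector ℝ d
    b′ = updateAt b i (const w)

    -- Translates coordinates with respect to `b′` into coordinates with respect to `b`.
    old : (Fin d → ℝ) → Fin d → ℝ
    old c j = updateAt c i (const 0#) j + c i * α j

    combination-b′ : ∀ c → combination c b′ ≋ combination (old c) b
    combination-b′ c a = begin
      combination c b′ a
        ≈⟨ lin-replace c b i w a ⟩
      combination (updateAt c i (const 0#)) b a + c i * w a
        ≈⟨ +-congˡ (trans (*-congˡ (w≋ a)) (sym (lin-* (c i) α b a))) ⟩
      combination (updateAt c i (const 0#)) b a + combination (λ j → c i * α j) b a
        ≈⟨ lin-+ (updateAt c i (const 0#)) (λ j → c i * α j) b a ⟨
      combination (old c) b a ∎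

    old-i : ∀ c → old c i ≈ c i * α i
    old-i c = trans (+-congʳ (reflexive (updateAt-updates i c))) (+-identityˡ _)

    old-j : ∀ c {j} → j ≢ i → old c j ≈ c j + c i * α j
    old-j c {j} j≢i = +-congʳ (reflexive (updateAt-minimal j i c j≢i))

    -- The translation `old` is invertible because `α i` is: coordinate `i` determines `c i`, and
    -- the remaining coordinates then determine the remaining entries of `c`.
    exchanged : IsBasis b′
    exchanged = record { independent = indep ; spanning = span }
      where
      indep : LinearlyIndependent b′
      indep c eq = go
        where
        old≈0 : ∀ j → old c j ≈ 0#
        old≈0 = independent (old c) λ a → trans (sym (combination-b′ c a)) (eq a)
        cᵢ≈0 : c i ≈ 0#
        cᵢ≈0 = ≉0-product αᵢ≉0 (trans (*-comm _ _) (trans (sym (old-i c)) (old≈0 i)))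
        go : ∀ j → c j ≈ 0#
        go j with j ≟ i
        ... | yes ≡.refl = cᵢ≈0
        ... | no j≢i     = begin
          c j              ≈⟨ +-identityʳ _ ⟨
          c j + 0#         ≈⟨ +-congˡ (trans (*-congʳ cᵢ≈0) (zeroˡ _)) ⟨
          c j + c i * α j  ≈⟨ old-j c j≢i ⟨
          old c j          ≈⟨ old≈0 j ⟩
          0#               ∎

      span : ∀ x → ∃[ c ] x ≋ combination c b′
      span x = c , λ a → trans (proj₂ (spanning x) a)
                 (trans (lin-congˡ {s = b} (sym ∘ old-c)) (sym (combination-b′ c a)))
        where
        t = proj₁ (spanning x)
        -- To solve `old c ≈ t`, coordinate `i` forces this quotient; every other coordinate is
        -- corrected by `q * α j`.
        q = t i * proj₁ (inverse (α i) αᵢ≉0)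
        t′ : Fin d → ℝ
        t′ j = t j - q * α j
        c : Fin d → ℝ
        c = updateAt t′ i (const q)
        c-i : c i ≈ q
        c-i = reflexive (updateAt-updates i t′)
        old-c : ∀ j → old c j ≈ t j
        old-c j with j ≟ i
        ... | yes ≡.refl = begin
          old c j                              ≈⟨ old-i c ⟩
          c j * α j                            ≈⟨ *-congʳ c-i ⟩
          q * α j                              ≈⟨ *-assoc _ _ _ ⟩
          t j * (proj₁ (inverse (α j) αᵢ≉0) * α j)
            ≈⟨ *-congˡ (trans (*-comm _ _) (proj₂ (inverse (α j) αᵢ≉0))) ⟩
          t j * 1#                             ≈⟨ *-identityʳ _ ⟩
          t j                                  ∎
        ... | no j≢i = begin
          old c j              ≈⟨ old-j c j≢i ⟩
          c j + c i * α j
            ≈⟨ +-cong (reflexive (updateAt-minimal j i t′ j≢i)) (*-congʳ c-i) ⟩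
          t′ j + q * α j       ≈⟨ restore-right (t j) (q * α j) ⟩
          t j                  ∎

  -- Extracting a basis from a spanning set.

  module _ (em : ExcludedMiddle 0ℓ) where

    -- If the `i`-th coordinate vanished on `S`, it would vanish on the whole span, in particular on
    -- `b i`, where it equals `1#`.
    nonzero-coordinate : {S : Pred (Vector ℝ d) 0ℓ} → (∀ x → x ∈ Span S) →
      {b : Fin d → Vector ℝ d} → IsBasis b → ∀ i →
      ∃[ w ] (w ∈ S × ∃[ α ] (w ≋ combination α b × ¬ (α i ≈ 0#)))
    nonzero-coordinate {S = S} S-spans {b} basis i
      with em {∃[ w ] (w ∈ S × ∃[ α ] (w ≋ combination α b × ¬ (α i ≈ 0#)))}
    ... | yes found = found
    ... | no  none  = contradiction 1≈0 1≉0
      where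
      open IsBasis basis
      m = proj₁ (S-spans (b i))
      c = proj₁ (proj₂ (S-spans (b i)))
      s = proj₁ (proj₂ (proj₂ (S-spans (b i))))
      s∈S = proj₁ (proj₂ (proj₂ (proj₂ (S-spans (b i)))))
      bᵢ≋ = proj₂ (proj₂ (proj₂ (proj₂ (S-spans (b i)))))
      α : Fin m → Fin _ → ℝ
      α j = proj₁ (spanning (s j))
      αᵢ≈0 : ∀ j → α j i ≈ 0#
      αᵢ≈0 j with em {α j i ≈ 0#}
      ... | yes eq = eq
      ... | no αᵢ≉0 = contradiction (s j , s∈S j , α j , proj₂ (spanning (s j)) , αᵢ≉0) none
      1≈0 : 1# ≈ 0#
      1≈0 = begin
        1#         ≈⟨ unit-diag i ⟨
        unit i i   ≈⟨ unique (unit i) (lin c α) (λ a → begin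
          combination (unit i) b a                ≈⟨ lin-unitˡ i b a ⟩
          b i a                                   ≈⟨ bᵢ≋ a ⟩
          combination c s a
            ≈⟨ lin-cong {c = c} {s = s} {s′ = λ j → combination (α j) b}
                 (λ _ → refl) (λ j → proj₂ (spanning (s j)) a) ⟩
          lin c (λ j → combination (α j) b) a     ≈⟨ lin-lin c α b a ⟩
          combination (lin c α) b a               ∎) i ⟩
        lin c α i  ≈⟨ lin-zeroʳ {c = c} {s = α} αᵢ≈0 ⟩
        0#         ∎

    -- Starts from the standard basis and exchanges one position at a time. After `k` exchanges the
    -- first `k` vectors lie in `S`; the next one is replaced by an element of `S` with a nonzero
    -- coordinate there.
    basis-within : (S : Pred (Vector ℝ d) 0ℓ) → (∀ x → x ∈ Span S) →
                   ∃[ b ] (IsBasis b × ∀ j → b j ∈ S)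
    basis-within {d} S S-spans with partial d ℕ.≤-refl
      where
      partial : ∀ k → k ℕ.≤ d → ∃[ b ] (IsBasis {d} b × ∀ j → toℕ j ℕ.< k → b j ∈ S)
      partial zero    _   = unit , unit-isBasis , λ _ ()
      partial (suc k) k<d with partial k (ℕ.<⇒≤ k<d)
      ... | b , basis , b∈S with nonzero-coordinate S-spans basis (fromℕ< k<d)
      ... | w , w∈S , α , w≋ , αᵢ≉0 =
        updateAt b i (const w) , Exchange.exchanged basis i w≋ αᵢ≉0 , members
        where
        i = fromℕ< k<d
        members : ∀ j → toℕ j ℕ.< suc k → updateAt b i (const w) j ∈ S
        members j j<1+k with j ≟ i
        ... | yes ≡.refl = subst S (≡.sym (updateAt-updates i b)) w∈S
        ... | no j≢i     = subst S (≡.sym (updateAt-minimal j i b j≢i))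
          (b∈S j (ℕ.≤∧≢⇒< (ℕ.s≤s⁻¹ j<1+k)
            λ j≡k → j≢i (toℕ-injective (≡.trans j≡k (≡.sym (toℕ-fromℕ< k<d))))))
    ... | b , basis , b∈S = b , basis , λ j → b∈S j (toℕ<n j)

    -- A nonzero x is recovered by contracting x ⊗ x with a coordinate functional.
    perfect⇒spanning : (Λ : Pred (Vector ℝ d) 0ℓ) → Perfect Λ → ∀ x → x ∈ Span (Minimal Λ)
    perfect⇒spanning Λ perfect x with em {∃[ a ] ¬ (x a ≈ 0#)}
    ... | no  none = 0 , (λ ()) , (λ ()) , (λ ()) , x≈0
      where
      x≈0 : ∀ a → x a ≈ 0#
      x≈0 a with em {x a ≈ 0#}
      ... | yes eq   = eq
      ... | no xₐ≉0 = contradiction (a , xₐ≉0) none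
    ... | yes (a , xₐ≉0) with proj₂ perfect {x ⊗ x} (λ i j → *-comm (x i) (x j))
    ... | k , c , s , s∈ , eq =
      k , (λ j → y * (c j * w j a)) , w , (λ j → proj₁ (proj₂ (s∈ j))) , x≋
      where
      w : Fin k → Vector ℝ _
      w j = proj₁ (s∈ j)
      y = proj₁ (inverse (x a) xₐ≉0)
      x≋ : x ≋ combination (λ j → y * (c j * w j a)) w
      x≋ b = sym (begin
        combination (λ j → y * (c j * w j a)) w b
          ≈⟨ sum-cong-≋ {k} (λ j → trans (*-assoc _ _ _) (*-congˡ (trans (*-assoc _ _ _)
               (*-congˡ (sym (proj₂ (proj₂ (s∈ j)) (a , b))))))) ⟩
        _ ≈⟨ *-distribˡ-sum y (λ j → c j * s j (a , b)) ⟨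
        y * combination c s (a , b)   ≈⟨ *-congˡ (eq (a , b)) ⟨
        y * (x a * x b)               ≈⟨ *-assoc _ _ _ ⟨
        (y * x a) * x b               ≈⟨ *-congʳ (trans (*-comm _ _) (proj₂ (inverse (x a) xₐ≉0))) ⟩
        1# * x b                      ≈⟨ *-identityˡ _ ⟩
        x b                           ∎)

  -- Lattices as subgroups of ℝᵈ, and integer spans.

  record IsSublattice (Λ : Pred (Vector ℝ d) 0ℓ) : Set where
    field
      resp   : ∀ {x y} → x ≋ y → x ∈ Λ → y ∈ Λ
      0∈ : 𝟎 ∈ Λ
      closed : ∀ p {x y} → x ∈ Λ → y ∈ Λ → (λ a → x a + fromℤ p * y a) ∈ Λ

    scale : ∀ p {x} → x ∈ Λ → (λ a → fromℤ p * x a) ∈ Λ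
    scale p x∈ = resp (λ a → +-identityˡ _) (closed p 0∈ x∈)

    diff : ∀ {x y} → x ∈ Λ → y ∈ Λ → (x -ᵥ y) ∈ Λ
    diff {x} {y} x∈ y∈ = resp (λ a → +-congˡ
      (trans (*-congʳ (-‿cong (+-identityʳ 1#))) (-1*x≈-x (y a)))) (closed (ℤ.- 1ℤ) x∈ y∈)

    combination-closed : ∀ {k} β (s : Fin k → Vector ℝ d) → (∀ j → s j ∈ Λ) →
                         ℤ-combination β s ∈ Λ
    combination-closed {zero}  β s s∈ = 0∈
    combination-closed {suc k} β s s∈ = resp (λ a → +-comm _ _)
      (closed (β zero) (combination-closed (β ∘ suc) (s ∘ suc) (s∈ ∘ suc)) (s∈ zero))

  ℤ-combination-* : ∀ p (z : Fin k → ℤ) (b : Fin k → A → ℝ) →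
    ℤ-combination (λ j → p ℤ.* z j) b ≋ (λ a → fromℤ p * ℤ-combination z b a)
  ℤ-combination-* p z b a = trans (lin-congˡ {s = b} λ j → fromℤ-* p (z j))
                                  (lin-* (fromℤ p) (fromℤ ∘ z) b a)

  ℤ-combination-+* : ∀ p (z z′ : Fin k → ℤ) (b : Fin k → A → ℝ) →
    ℤ-combination (λ j → z j ℤ.+ p ℤ.* z′ j) b ≋
    (λ a → ℤ-combination z b a + fromℤ p * ℤ-combination z′ b a)
  ℤ-combination-+* p z z′ b a = begin
    ℤ-combination (λ j → z j ℤ.+ p ℤ.* z′ j) b a
      ≈⟨ lin-congˡ {s = b} (λ j → fromℤ-+ (z j) (p ℤ.* z′ j)) ⟩
    lin (λ j → fromℤ (z j) + fromℤ (p ℤ.* z′ j)) b a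
      ≈⟨ lin-+ (fromℤ ∘ z) (λ j → fromℤ (p ℤ.* z′ j)) b a ⟩
    ℤ-combination z b a + ℤ-combination (λ j → p ℤ.* z′ j) b a
      ≈⟨ +-congˡ (ℤ-combination-* p z′ b a) ⟩
    ℤ-combination z b a + fromℤ p * ℤ-combination z′ b a ∎

  ℤ-combination-0 : (b : Fin k → A → ℝ) → ℤ-combination (const 0ℤ) b ≋ 𝟎
  ℤ-combination-0 {k = k} b a = lin-zeroˡ {c = λ (_ : Fin k) → 0#} {s = b} λ _ → refl

  ℤ-span : (Fin k → Vector ℝ d) → Pred (Vector ℝ d) 0ℓ
  ℤ-span b v = ∃[ β ] v ≋ ℤ-combination β b

  ∈-ℤ-span : ∀ (b : Fin k → Vector ℝ d) i → b i ∈ ℤ-span b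
  ∈-ℤ-span b i = Linℤ.unit i , λ a → trans (sym (lin-unitˡ i b a))
    (lin-congˡ {s = b} λ j → unit-fromℤ j)
    where
    unit-fromℤ : ∀ j → unit i j ≈ fromℤ (Linℤ.unit i j)
    unit-fromℤ j with i ≟ j
    ... | yes _ = sym (+-identityʳ 1#)
    ... | no  _ = refl

  ℤ-span-isSublattice : (b : Fin k → Vector ℝ d) → IsSublattice (ℤ-span b)
  ℤ-span-isSublattice b = record
    { resp   = λ x≋y (β , x≋) → β , λ a → trans (sym (x≋y a)) (x≋ a)
    ; 0∈ = const 0ℤ , λ a → sym (ℤ-combination-0 b a)
    ; closed = λ p (β , x≋) (γ , y≋) → (λ j → β j ℤ.+ p ℤ.* γ j) , λ a → trans
        (+-cong (x≋ a) (*-congˡ (y≋ a))) (sym (ℤ-combination-+* p β γ b a))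
    }

  isSublattice : {Λ : Pred (Vector ℝ d) 0ℓ} → IsLattice Λ → IsSublattice Λ
  isSublattice (b , _ , Λ⇔) = record
    { resp   = λ x≋y x∈ → from (Λ⇔ _) (resp x≋y (to (Λ⇔ _) x∈))
    ; 0∈ = from (Λ⇔ _) 0∈
    ; closed = λ p x∈ y∈ → from (Λ⇔ _) (closed p (to (Λ⇔ _) x∈) (to (Λ⇔ _) y∈))
    }
    where
    open Equivalence using (to; from)
    open IsSublattice (ℤ-span-isSublattice b)

  -- Finite index: multiples and common denominators.

  multiples-difference : ∀ i m (x r : Vector ℝ d) →
    (((λ a → fromℤ (+ (suc m ℕ.+ i)) * x a) -ᵥ r) -ᵥ ((λ a → fromℤ (+ i) * x a) -ᵥ r))
    ≋ (λ a → fromℤ (+ suc m) * x a)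
  multiples-difference i m x r a = begin
    (fromℤ (+ (suc m ℕ.+ i)) * x a - r a) - (fromℤ (+ i) * x a - r a)
      ≈⟨ +-congʳ (+-congʳ (trans (*-congʳ (×-homo-+ 1# (suc m) i)) (distribʳ (x a) _ _))) ⟩
    ((fromℤ (+ suc m) * x a + fromℤ (+ i) * x a) - r a) - (fromℤ (+ i) * x a - r a)
      ≈⟨ +-congʳ (+-assoc _ _ _) ⟩
    (fromℤ (+ suc m) * x a + (fromℤ (+ i) * x a - r a)) - (fromℤ (+ i) * x a - r a)
      ≈⟨ cancel-right _ _ ⟩
    fromℤ (+ suc m) * x a ∎

  -- Among the `n + 1` multiples of `x` by `0` to `n`, two share one of the `n` cosets by the
  -- pigeonhole principle. Their difference is a positive multiple of `x`, by at most `n`, in `Λ′`.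
  multiple-in-sublattice : {Λ Λ′ : Pred (Vector ℝ d) 0ℓ} {n : ℕ} →
    IsSublattice Λ → IsSublattice Λ′ → HasIndex Λ Λ′ n → ∀ {x} → x ∈ Λ →
    ∃[ m ] (suc m ℕ.≤ n × (λ a → fromℤ (+ suc m) * x a) ∈ Λ′)
  multiple-in-sublattice {d} {Λ} {Λ′} {n} Λ-sub Λ′-sub index {x} x∈Λ =
    let i , j , i<j , same = pigeonhole (ℕ.n<1+n n) (proj₁ ∘ coset)
    in conclude (proj₁ (coset j)) (toℕ i) (toℕ j) i<j (toℕ<n j)
         (subst (λ r → (mult (toℕ i) -ᵥ rep r) ∈ Λ′) same (proj₂ (coset i))) (proj₂ (coset j))
    where
    open HasIndex index
    open IsSublattice Λ′-sub
    mult : ℕ → Vector ℝ d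
    mult c a = fromℤ (+ c) * x a
    coset : ∀ (c : Fin (suc n)) → ∃[ r ] (mult (toℕ c) -ᵥ rep r) ∈ Λ′
    coset c = covers (IsSublattice.scale Λ-sub (+ toℕ c) x∈Λ)
    conclude : ∀ r i j → i ℕ.< j → j ℕ.< suc n →
      (mult i -ᵥ rep r) ∈ Λ′ → (mult j -ᵥ rep r) ∈ Λ′ → ∃[ m ] (suc m ℕ.≤ n × mult (suc m) ∈ Λ′)
    conclude r i j i<j j<1+n i∈ j∈ with ℕ.m≤n⇒∃[o]m+o≡n i<j
    -- Writes `j` as `suc m + i`, the shape expected by `multiples-difference`.
    ... | m , ≡.refl rewrite ℕ.+-comm i m = m , ℕ.≤-trans (ℕ.m≤m+n (suc m) i) (ℕ.s≤s⁻¹ j<1+n) ,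
      resp (multiples-difference i m x (rep r)) (diff j∈ i∈)

  -- A nonzero vector forces positive dimension, so there is a basis vector to compare lengths with;
  -- any index will do, whatever the coordinate of `v` there.
  nonzero⇒index : (v : Vector ℝ d) → ¬ (v ≋ 𝟎) → Fin d
  nonzero⇒index {zero}  v v≉0 = contradiction (λ ()) v≉0
  nonzero⇒index {suc _} _ _   = zero

  module _ {d I} (bounded : IndexBound d I) {Λ : Pred (Vector ℝ d) 0ℓ} (lattice : IsLattice Λ) where
    open IsSublattice (isSublattice lattice)

    -- The `b j` stay minimal in the smaller lattice they generate, so it is well-rounded. A minimal
    -- vector of that lattice is no longer than a `b j`, hence is minimal in `Λ` too, and the index
    -- bound applies.
    index-of-minimal-basis : {b : Fin d → Vector ℝ d} → IsBasis b → (∀ j → b j ∈ Minimal Λ) →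
                             ∃[ n ] (HasIndex Λ (ℤ-span b) n × n ℕ.≤ I)
    index-of-minimal-basis {b} basis b-min = bounded Λ (ℤ-span b) lattice
      (b , independent , λ _ → mk⇔ id id) ⊆Λ wellRounded minimal⊆
      where
      open IsBasis basis
      ⊆Λ : ℤ-span b ⊆ Λ
      ⊆Λ (β , v≋) = resp (λ a → sym (v≋ a)) (combination-closed β b (proj₁ ∘ b-min))
      wellRounded : WellRounded (ℤ-span b)
      wellRounded x = d , proj₁ (spanning x) , b ,
        (λ j → ∈-ℤ-span b j , proj₁ (proj₂ (b-min j)) ,
               λ w∈ → proj₂ (proj₂ (b-min j)) (⊆Λ w∈)) , proj₂ (spanning x)
      minimal⊆ : Minimal (ℤ-span b) ⊆ Minimal Λ
      minimal⊆ {v} (v∈ , v≉0 , v-min) = ⊆Λ v∈ , v≉0 , λ w∈ w≉0 → ≤-trans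
        (v-min (∈-ℤ-span b j) (proj₁ (proj₂ (b-min j)))) (proj₂ (proj₂ (b-min j)) w∈ w≉0)
        where j = nonzero⇒index v v≉0

  -- z / N are the coordinates of x with respect to b.
  Numerators : (b : Fin d → Vector ℝ d) → ℤ → (Fin d → ℤ) → Vector ℝ d → Set
  Numerators b N z x = ℤ-combination z b ≋ (λ a → fromℤ N * x a)

  -- The multiplier that brings `x` into the span varies with `x` but is at most `n`, so it divides
  -- `n !`, which therefore serves all of `Λ` at once.
  common-denominator : {Λ : Pred (Vector ℝ d) 0ℓ} {b : Fin d → Vector ℝ d} {n : ℕ} →
    IsSublattice Λ → HasIndex Λ (ℤ-span b) n →
    ∃[ N ] (ℤ.NonZero N × (∀ {x} → x ∈ Λ → ∃[ z ] Numerators b N z x))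
  common-denominator {Λ = Λ} {b} {n} Λ-sub index = + (n !) , ℕ._!≢0 n , numerators
    where
    numerators : ∀ {x} → x ∈ Λ → ∃[ z ] Numerators b (+ (n !)) z x
    numerators {x} x∈Λ with multiple-in-sublattice Λ-sub (ℤ-span-isSublattice b) index x∈Λ
    ... | m , m<n , β , mx≋ with ∣-trans (m∣m*n {suc m} (m !)) (m≤n⇒m!∣n! m<n)
    ... | divides q n!≡ = (λ j → + q ℤ.* β j) , λ a → begin
      ℤ-combination (λ j → + q ℤ.* β j) b a
        ≈⟨ ℤ-combination-* (+ q) β b a ⟩
      fromℤ (+ q) * ℤ-combination β b a
        ≈⟨ *-congˡ (mx≋ a) ⟨
      fromℤ (+ q) * (fromℤ (+ suc m) * x a)
        ≈⟨ *-assoc _ _ _ ⟨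
      (fromℤ (+ q) * fromℤ (+ suc m)) * x a
        ≈⟨ *-congʳ (trans (reflexive (≡.cong (fromℤ ∘ +_) n!≡)) (×1-homo-* q (suc m))) ⟨
      fromℤ (+ (n !)) * x a ∎

  -- Integer numerators of lattice vectors and the size of coordinates.

  module Coordinates {d I} (bounded : IndexBound d I) {Λ : Pred (Vector ℝ d) 0ℓ}
    (lattice : IsLattice Λ) {b : Fin d → Vector ℝ d} (basis : IsBasis b)
    (b-min : ∀ j → b j ∈ Minimal Λ) (N : ℤ) .{{_ : ℤ.NonZero N}} where

    open IsBasis basis
    open IsSublattice (isSublattice lattice)

    fromℤN≉0 : ¬ (fromℤ N ≈ 0#)
    fromℤN≉0 N≈0 = ℕ.≢-nonZero⁻¹ ∣ N ∣ (≡.cong ∣_∣ (fromℤ-≡0 N N≈0))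

    _IsNumeratorOf_ : (Fin d → ℤ) → Vector ℝ d → Set
    _IsNumeratorOf_ = Numerators b N

    -- The lattice N Λ in the coordinates given by b.
    H : Pred (Fin d → ℤ) 0ℓ
    H z = ∃[ x ] (x ∈ Λ × z IsNumeratorOf x)

    numerators-cong : ∀ {z z′ : Fin d → ℤ} → z ≗ z′ → ℤ-combination z b ≋ ℤ-combination z′ b
    numerators-cong z≗z′ a = lin-congˡ {s = b} λ j → reflexive (≡.cong fromℤ (z≗z′ j))

    zero-num : const 0ℤ IsNumeratorOf 𝟎
    zero-num a = trans (ℤ-combination-0 b a) (sym (zeroʳ _))

    num-+* : ∀ p {z z′ x y} → z IsNumeratorOf x → z′ IsNumeratorOf y →
             (λ j → z j ℤ.+ p ℤ.* z′ j) IsNumeratorOf (λ a → x a + fromℤ p * y a)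
    num-+* p {z} {z′} {x} {y} eq eq′ a = begin
      ℤ-combination (λ j → z j ℤ.+ p ℤ.* z′ j) b a
        ≈⟨ ℤ-combination-+* p z z′ b a ⟩
      ℤ-combination z b a + fromℤ p * ℤ-combination z′ b a
        ≈⟨ +-cong (eq a) (*-congˡ (eq′ a)) ⟩
      fromℤ N * x a + fromℤ p * (fromℤ N * y a)
        ≈⟨ +-congˡ (x∙yz≈y∙xz (fromℤ p) (fromℤ N) (y a)) ⟩
      fromℤ N * x a + fromℤ N * (fromℤ p * y a)
        ≈⟨ distribˡ _ _ _ ⟨
      fromℤ N * (x a + fromℤ p * y a) ∎

    H-isSubgroup : IsSubgroup H
    H-isSubgroup = record
      { resp   = λ z≗z′ (x , x∈ , eq) → x , x∈ ,
          λ a → trans (numerators-cong (≡.sym ∘ z≗z′) a) (eq a)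
      ; 0∈ = 𝟎 , 0∈ , zero-num
      ; closed = λ p {z} {z′} (x , x∈ , eq) (y , y∈ , eq′) →
          (λ a → x a + fromℤ p * y a) , closed p x∈ y∈ , num-+* p {z} {z′} {x} {y} eq eq′
      }

    -- The integer combinations of `b` already lie in `Λ`. This is the full-rank hypothesis of
    -- `reduced-basis`.
    multiples∈H : ∀ (z : Fin d → ℤ) → (λ j → N ℤ.* z j) ∈ H
    multiples∈H z = ℤ-combination z b , combination-closed z b (proj₁ ∘ b-min) ,
                    ℤ-combination-* N z b

    numerators-unique : ∀ {z z′ x} → z IsNumeratorOf x → z′ IsNumeratorOf x → z ≗ z′
    numerators-unique {z} {z′} eq eq′ j = fromℤ-injective (z j) (z′ j)
      (unique (fromℤ ∘ z) (fromℤ ∘ z′) (λ a → trans (eq a) (sym (eq′ a))) j)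

    -- Passing to numerators is linear, so a combination of vectors can be studied through integer
    -- rows with the same coefficients.
    numerators-lin : ∀ {k} (z : Fin k → Fin d → ℤ) (x : Fin k → Vector ℝ d) →
      (∀ i → z i IsNumeratorOf x i) → ∀ β → linℤ β z IsNumeratorOf ℤ-combination β x
    numerators-lin z x eq β a = begin
      ℤ-combination (linℤ β z) b a
        ≈⟨ lin-congˡ {s = b} (fromℤ-lin β z) ⟩
      lin (lin (fromℤ ∘ β) (λ i → fromℤ ∘ z i)) b a
        ≈⟨ lin-lin (fromℤ ∘ β) (λ i → fromℤ ∘ z i) b a ⟨
      lin (fromℤ ∘ β) (λ i → ℤ-combination (z i) b) a
        ≈⟨ lin-cong {c = fromℤ ∘ β} {s = λ i → ℤ-combination (z i) b}
             {s′ = λ i a → fromℤ N * x i a} (λ _ → refl) (λ i → eq i a) ⟩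
      lin (fromℤ ∘ β) (λ i a → fromℤ N * x i a) a
        ≈⟨ lin-scale (fromℤ N) (fromℤ ∘ β) x a ⟩
      fromℤ N * ℤ-combination β x a ∎

    -- Exchanging b i for the minimal vector w gives a sublattice of index at most I
    -- all of whose i-th coordinates are multiples of z i / N.
    numerator-bound : ∀ {w z x y} → w ∈ Minimal Λ → z IsNumeratorOf w →
                      x ∈ Λ → y IsNumeratorOf x → ∀ i → y i ≢ 0ℤ →
                      ∣ z i ∣ ℕ.≤ I ℕ.* ∣ y i ∣
    numerator-bound {w} {z} {x} {y} w-min z-num x∈Λ y-num i yᵢ≢0 with z i ℤ.≟ 0ℤ
    ... | yes zᵢ≡0 = subst (λ e → ∣ e ∣ ℕ.≤ _) (≡.sym zᵢ≡0) ℕ.z≤n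
    ... | no  zᵢ≢0 =
      let n , index , n≤I = index-of-minimal-basis bounded lattice exchanged
                              (updateAt-∈ (Minimal Λ) b i b-min w-min)
          m , m<n , γ , eq = multiple-in-sublattice (isSublattice lattice)
                               (ℤ-span-isSublattice b′) index x∈Λ
      in conclude m (ℕ.≤-trans m<n n≤I) (γ i) (product m γ eq)
      where
      α = proj₁ (spanning w)
      Nα≈z : ∀ j → fromℤ N * α j ≈ fromℤ (z j)
      Nα≈z = unique (λ j → fromℤ N * α j) (fromℤ ∘ z) λ a → trans (lin-* (fromℤ N) α b a)
        (trans (*-congˡ (sym (proj₂ (spanning w) a))) (sym (z-num a)))
      αᵢ≉0 : ¬ (α i ≈ 0#)
      αᵢ≉0 αᵢ≈0 = zᵢ≢0 (fromℤ-≡0 (z i)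
        (trans (sym (Nα≈z i)) (trans (*-congˡ αᵢ≈0) (zeroʳ _))))
      open Exchange basis i (proj₂ (spanning w)) αᵢ≉0

      -- Compares the `i`-th coordinates of `suc m` times `x`, scaled by `N`: among the vectors of
      -- `b′` only `w` has a nonzero one.
      product : ∀ m γ → (λ a → fromℤ (+ suc m) * x a) ≋ ℤ-combination γ b′ →
                + suc m ℤ.* y i ≡ γ i ℤ.* z i
      product m γ eq = fromℤ-injective (+ suc m ℤ.* y i) (γ i ℤ.* z i) (begin
        fromℤ (+ suc m ℤ.* y i)        ≈⟨ fromℤ-* (+ suc m) (y i) ⟩
        M * fromℤ (y i)
          ≈⟨ unique (λ j → M * fromℤ (y j)) (λ j → fromℤ N * old (fromℤ ∘ γ) j) scaled i ⟩
        fromℤ N * old (fromℤ ∘ γ) i    ≈⟨ *-congˡ (old-i (fromℤ ∘ γ)) ⟩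
        fromℤ N * (fromℤ (γ i) * α i)  ≈⟨ x∙yz≈y∙xz (fromℤ N) (fromℤ (γ i)) (α i) ⟩
        fromℤ (γ i) * (fromℤ N * α i)  ≈⟨ *-congˡ (Nα≈z i) ⟩
        fromℤ (γ i) * fromℤ (z i)      ≈⟨ fromℤ-* (γ i) (z i) ⟨
        fromℤ (γ i ℤ.* z i)            ∎)
        where
        M = fromℤ (+ suc m)
        scaled : combination (λ j → M * fromℤ (y j)) b
                 ≋ combination (λ j → fromℤ N * old (fromℤ ∘ γ) j) b
        scaled a = begin
          combination (λ j → M * fromℤ (y j)) b a
            ≈⟨ lin-* M (fromℤ ∘ y) b a ⟩
          M * ℤ-combination y b a
            ≈⟨ *-congˡ (y-num a) ⟩
          M * (fromℤ N * x a)
            ≈⟨ x∙yz≈y∙xz M (fromℤ N) (x a) ⟩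
          fromℤ N * (M * x a)
            ≈⟨ *-congˡ (trans (eq a) (combination-b′ (fromℤ ∘ γ) a)) ⟩
          fromℤ N * combination (old (fromℤ ∘ γ)) b a
            ≈⟨ lin-* (fromℤ N) (old (fromℤ ∘ γ)) b a ⟨
          combination (λ j → fromℤ N * old (fromℤ ∘ γ) j) b a ∎

      conclude : ∀ m → suc m ℕ.≤ I → ∀ g → + suc m ℤ.* y i ≡ g ℤ.* z i →
                 ∣ z i ∣ ℕ.≤ I ℕ.* ∣ y i ∣
      conclude m m<I g eq = R.begin
        -- Here `g` is nonzero because `y i` is, so multiplying by it cannot decrease the absolute
        -- value.
        ∣ z i ∣              R.≤⟨ ℕ.m≤n*m ∣ z i ∣ ∣ g ∣ {{∣g∣-nonZero}} ⟩
        ∣ g ∣ ℕ.* ∣ z i ∣    R.≡⟨ ℤ.abs-* g (z i) ⟨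
        ∣ g ℤ.* z i ∣        R.≡⟨ ≡.cong ∣_∣ eq ⟨
        ∣ + suc m ℤ.* y i ∣  R.≡⟨ ℤ.abs-* (+ suc m) (y i) ⟩
        suc m ℕ.* ∣ y i ∣    R.≤⟨ ℕ.*-monoˡ-≤ ∣ y i ∣ m<I ⟩
        I ℕ.* ∣ y i ∣        R.∎
        where
        module R = ℕ.≤-Reasoning
        ∣g∣-nonZero : ℕ.NonZero ∣ g ∣
        ∣g∣-nonZero = ℕ.≢-nonZero λ ∣g∣≡0 → yᵢ≢0 (ℤ.*-cancelˡ-≡ (+ suc m) (y i) 0ℤ (≡.trans eq
          (≡.trans (≡.cong (ℤ._* z i) (ℤ.∣i∣≡0⇒i≡0 {g} ∣g∣≡0)) (≡.sym (ℤ.*-zeroʳ (+ suc m))))))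

    module _ {g : Fin d → Fin d → ℤ} (g-reduced : IsReduced d g) {f : Fin d → Vector ℝ d}
             (f∈Λ : ∀ i → f i ∈ Λ) (g-num : ∀ i → g i IsNumeratorOf f i) where

      -- Coefficients for the rows of `g` are coefficients for `f`, since the factor `fromℤ N`
      -- between vectors and numerators can be cancelled.
      reduced⇒isℤBasis : (∀ {x} → x ∈ Λ → ∃[ z ] z IsNumeratorOf x) →
                         (∀ {z} → z ∈ H → ∃[ β ] z ≗ linℤ β g) → IsℤBasis Λ f
      reduced⇒isℤBasis numerators generates-H = record
        { members = f∈Λ ; generates = generates ; independent = f-independent }
        where
        generates : ∀ {v} → v ∈ Λ → ∃[ β ] v ≋ ℤ-combination β f
        generates v∈Λ =
          let z , z-num = numerators v∈Λ
              β , z≗    = generates-H {z} (_ , v∈Λ , z-num)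
          in β , λ a → *-cancelˡ-nonzero (fromℤ N) fromℤN≉0 (trans (sym (z-num a))
               (trans (numerators-cong {z} z≗ a) (numerators-lin g f g-num β a)))
        f-independent : ∀ β → ℤ-combination β f ≋ 𝟎 → ∀ i → β i ≡ 0ℤ
        -- A zero combination has zero numerators, so the coefficient bound applies with constant
        -- `0`.
        f-independent β eq i = ℤ.∣i∣≡0⇒i≡0 (ℕ.n≤0⇒n≡0 (ℕ.≤-trans
          (coefficient-bound d g g-reduced 0 β (λ j → ℕ.≤-reflexive (≡.cong ∣_∣ (zero-lin j))) i)
          (ℕ.≤-reflexive (ℕ.*-zeroʳ (2 ^ toℕ i)))))
          where
          zero-lin : linℤ β g ≗ const 0ℤ
          zero-lin = numerators-unique {linℤ β g} {const 0ℤ}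
            (λ a → trans (numerators-lin g f g-num β a) (*-congˡ (eq a))) zero-num

      -- The numerators of `v` are `linℤ β g`. Comparing `v` with `f i`, whose `i`-th numerator is
      -- the nonzero diagonal entry `g i i`, gives the hypothesis of `coefficient-bound` with
      -- constant `I`.
      reduced⇒bound : ∀ v → v ∈ Minimal Λ → (β : Fin d → ℤ) → v ≋ ℤ-combination β f →
                      ∀ i → ∣ β i ∣ ℕ.≤ 2 ^ toℕ i ℕ.* I
      reduced⇒bound v v-min β v≋ = coefficient-bound d g g-reduced I β λ i →
        numerator-bound {v} {linℤ β g} {f i} {g i} v-min
          (λ a → trans (numerators-lin g f g-num β a) (*-congˡ (sym (v≋ a))))
          (f∈Λ i) (g-num i) i (diagonal-nonZero d g g-reduced i)

-- Assembling the basis of a perfect lattice.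

open import Data.Nat.Base using (_*_; _≤_)

theorem17p1 : ExcludedMiddle 0ℓ → (ℝ-field : CompleteOrderedField) →
    let open Lattices ℝ-field in
    (d I : ℕ) → IsMaximalIndex d I →
    (Λ : Pred (Vector ℝ d) 0ℓ) → IsLattice Λ → Perfect Λ →
    Σ[ f ∈ (Fin d → Vector ℝ d) ] (IsℤBasis Λ f ×
    (∀ v → v ∈ Minimal Λ → (β : Fin d → ℤ) → v ≋ ℤ-combination β f →
    ∀ i → ∣ β i ∣ ≤ 2 ^ toℕ i * I))
theorem17p1 em ℝ-field d I (bounded , _) Λ lattice perfect =
  let b , basis , b-min        = basis-within em (Minimal Λ) (perfect⇒spanning em Λ perfect)
      n , index , _            = index-of-minimal-basis bounded lattice basis b-min
      N , N≢0 , numerators     = common-denominator (isSublattice lattice) index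
  in conclude b basis b-min N N≢0 numerators
  where
  open Lattices ℝ-field
  open Field ℝ-field
  conclude : ∀ b → IsBasis b → (∀ j → b j ∈ Minimal Λ) → ∀ N → ℤ.NonZero N →
             (∀ {x} → x ∈ Λ → ∃[ z ] Numerators b N z x) →
             Σ[ f ∈ (Fin d → Vector ℝ d) ] (IsℤBasis Λ f ×
               (∀ v → v ∈ Minimal Λ → (β : Fin d → ℤ) → v ≋ ℤ-combination β f →
               ∀ i → ∣ β i ∣ ≤ 2 ^ toℕ i * I))
  conclude b basis b-min N N≢0 numerators =
    -- Membership of a row in `H` carries the lattice vector with those numerators; these vectors
    -- are the basis sought.
    let g , g-reduced , g∈H , generates = reduced-basis em d H H-isSubgroup N multiples∈H
        f∈Λ   = λ i → proj₁ (proj₂ (g∈H i))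
        g-num = λ i → proj₂ (proj₂ (g∈H i))
    in (λ i → proj₁ (g∈H i)) , reduced⇒isℤBasis g-reduced f∈Λ g-num numerators generates ,
       reduced⇒bound g-reduced f∈Λ g-num
    where
    instance _ = N≢0
    open Coordinates bounded lattice basis b-min N
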